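{- Let $d>0$ be an integer. (a) Every finite convex $P\subseteq\mathbb{N}^d$ that is not a chain satisfies $\pi(P)\ge |P|/2-1$. (b) There is a constant $C_d$ depending only on $d$ such that every finite ideal $P$ of $\mathbb{N}^d$ not contained in a coordinate hyperplane satisfies $\pi(P)>(1-1/d)|P|-C_d$.
   Context: $\mathbb{N}^d$ carries the product (coordinatewise) order, and subsets carry the induced order. $Q$ is convex if $x,z\in Q$ and $x<y<z$ imply $y\in Q$. An ideal (downset) of a poset $R$ is $I\subseteq R$ with $x<y\in I\Rightarrow x\in I$. For $x\in P$, $\pi(x)$ is the number of elements of $P$ incomparable to $x$ (neither $x<y$ nor $y<x$), and $\pi(P)=\max_{x\in P}\pi(x)$. -}

module Defs where

open import Data.Nat using (ℕ; _≤_; _⊔_)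
import Data.Nat.Properties as ℕP
open import Data.Fin using (Fin)
open import Data.Vec using (Vec; lookup)
open import Data.Vec.Relation.Binary.Pointwise.Inductive using (Pointwise; decidable)
open import Data.List using (List; length; filter; map; foldr)
open import Data.List.Membership.Propositional using (_∈_)
open import Data.Product using (_×_; ∃)
open import Data.Sum using (_⊎_)
open import Relation.Nullary using (¬_; Dec)
open import Relation.Nullary.Decidable using (¬?; _⊎-dec_)
open import Relation.Binary.PropositionalEquality using (_≡_; _≢_)

Pt : ℕ → Set
Pt d = Vec ℕ d

_≼_ : ∀ {d} → Pt d → Pt d → Set
_≼_ = Pointwise _≤_

_≼?_ : ∀ {d} (x y : Pt d) → Dec (x ≼ y)
_≼?_ = decidable ℕP._≤?_

_≺_ : ∀ {d} → Pt d → Pt d → Set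
x ≺ y = x ≼ y × x ≢ y

Incomparable : ∀ {d} → Pt d → Pt d → Set
Incomparable x y = ¬ (x ≼ y ⊎ y ≼ x)

incomparable? : ∀ {d} (x y : Pt d) → Dec (Incomparable x y)
incomparable? x y = ¬? ((x ≼? y) ⊎-dec (y ≼? x))

-- A finite subset of ℕ^d is represented by a duplicate-free list;
-- membership is list membership and |P| is the length.

πAt : ∀ {d} → List (Pt d) → Pt d → ℕ
πAt P x = length (filter (incomparable? x) P)

πP : ∀ {d} → List (Pt d) → ℕ
πP P = foldr _⊔_ 0 (map (πAt P) P)

Convex : ∀ {d} → List (Pt d) → Set
Convex {d} P = ∀ (x y z : Pt d) → x ∈ P → z ∈ P → x ≺ y → y ≺ z → y ∈ P

IsChain : ∀ {d} → List (Pt d) → Set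
IsChain {d} P = ∀ (x y : Pt d) → x ∈ P → y ∈ P → (x ≼ y ⊎ y ≼ x)

IsIdeal : ∀ {d} → List (Pt d) → Set
IsIdeal {d} P = ∀ (x y : Pt d) → x ≺ y → y ∈ P → x ∈ P

InCoordHyperplane : ∀ {d} → List (Pt d) → Set
InCoordHyperplane {d} P = ∃ λ (i : Fin d) → ∀ (x : Pt d) → x ∈ P → lookup x i ≡ 0

{-# OPTIONS --safe #-}

-- (a) Let x, y be an incomparable pair of P at maximal L¹ distance.  If P had an
-- upper bound u of x and y other than x ∨ y, then in each coordinate the larger
-- of x and y could be raised to that of u: convexity keeps both points in P,
-- they stay incomparable, and their distance grows.  The same holds below, so
-- only x ∨ y and x ∧ y can be comparable to both, and |P| ≤ π(x) + π(y) + 2.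
--
-- (b) It suffices to find x ∈ P with |↓x| + |↑x| ≤ |P|/d + O(1).  Let aᵢ be the
-- largest i-th coordinate in P and call i short if aᵢ + 1 < d.  To i we attach
-- the nonzero points of the i-th axis if i is long, and the points whose short
-- coordinates form the unit vector eᵢ if i is short.  These d sets are disjoint,
-- so one of them, S, has at most |P|/d points.  If i is long take x = aᵢeᵢ:
-- |↓x| ≤ |S| + 1, and the layers orthogonal to the axis decrease in size, whence
-- |↑x|(aᵢ + 1) ≤ |P|.  If i is short take a maximal x ∈ P supported on the short
-- coordinates with xᵢ > 0: ↓x lies in a box of at most dᵈ points, and replacing
-- the short coordinates x by eᵢ injects ↑x into S.
module Submission where

open import Defs
open import Data.Nat using (ℕ; _≤_; _<_; _+_; _*_; _∸_; NonZero)
open import Data.List using (List; length)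
open import Data.List.Relation.Unary.Unique.Propositional using (Unique)
open import Data.Product using (_×_; ∃)
open import Relation.Nullary using (¬_)

open import Data.Bool using (if_then_else_)
open import Data.Empty using (⊥-elim)
open import Data.Fin using (Fin; fromℕ<)
import Data.Fin.Properties as FinP
open import Data.Nat using (zero; suc; z≤n; s≤s; _⊔_; _⊓_; _^_; ∣_-_∣; >-nonZero; >-nonZero⁻¹)
open import Data.Nat.Properties
open import Data.Nat.Tactic.RingSolver using (solve-∀)
open import Data.List using ([]; _∷_; [_]; _++_; map; foldr; filter; concat; tabulate; upTo; allFin;
  cartesianProduct; cartesianProductWith)
open import Data.List.Extrema.Nat using (argmax; argmin; argmax-all; f[xs]≤f[argmax];
  f[argmin]≤f[xs])
open import Data.List.Membership.Propositional using (_∈_)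
open import Data.List.Membership.Propositional.Properties
  using (∈-++⁺ˡ; ∈-++⁺ʳ; ∈-++⁻; ∈-∃++; ∈-filter⁺; ∈-filter⁻; ∈-map⁺; ∈-upTo⁺; ∈-upTo⁻; ∈-allFin;
         ∈-concat⁻′; ∈-tabulate⁻; ∈-cartesianProduct⁺; ∈-cartesianProduct⁻; ∈-cartesianProductWith⁺)
open import Data.List.Properties using (length-++; length-map; length-upTo)
import Data.List.Relation.Unary.All as All
import Data.List.Relation.Unary.All.Properties as AllP
import Data.List.Relation.Unary.AllPairs.Properties as AllPairsP
open import Data.List.Relation.Unary.AllPairs using ([]; _∷_)
open import Data.List.Relation.Unary.Any using (here; there)
import Data.List.Relation.Unary.Unique.Propositional.Properties as Uniq
open import Data.Product using (_,_; proj₁; proj₂)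
open import Data.Sum using (_⊎_; inj₁; inj₂; [_,_]′)
open import Data.Vec using (Vec; []; _∷_; lookup; replicate; sum; zipWith; _[_]≔_)
import Data.Vec as Vec
open import Data.Vec.Properties
  using (lookup∘tabulate; lookup-zipWith; lookup-replicate; lookup∘update; lookup∘update′; ≡-dec)
open import Data.Vec.Relation.Binary.Pointwise.Inductive using ([]; _∷_; Pointwise-≡⇒≡)
import Data.Vec.Relation.Binary.Pointwise.Inductive as PW
import Data.Vec.Relation.Binary.Pointwise.Extensional as Ext
open import Function using (_∘_; id)
open import Relation.Binary.PropositionalEquality
  using (_≡_; _≢_; refl; sym; trans; cong; cong₂; subst; subst₂; ≢-sym)
open import Relation.Nullary using (Dec; yes; no; does; contradiction)
open import Relation.Nullary.Decidable
  using (¬?; _×-dec_; _⊎-dec_; _→-dec_; dec-true; dec-false; decidable-stable)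
open import Relation.Unary using (Decidable)

private variable
  A B C : Set
  d n : ℕ

-- Counting with lists

-- Induction on `xs`: deleting the image of the head from `ys` leaves a list that still receives the
-- images of the tail.
length-injection : (f : A → B) {xs : List A} {ys : List B} → Unique xs →
  (∀ {x} → x ∈ xs → f x ∈ ys) →
  (∀ {x y} → x ∈ xs → y ∈ xs → f x ≡ f y → x ≡ y) →
  length xs ≤ length ys
length-injection f {[]} _ _ _ = z≤n
length-injection f {x ∷ xs} {ys} (x≢ ∷ u) into inj with ∈-∃++ (into (here refl))
... | as , bs , refl = begin
  suc (length xs)               ≤⟨ s≤s (length-injection f u into′ (λ p q → inj (there p) (there q))) ⟩
  suc (length (as ++ bs))       ≡⟨ cong suc (length-++ as) ⟩
  suc (length as + length bs)   ≡⟨ sym (+-suc (length as) (length bs)) ⟩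
  length as + suc (length bs)   ≡⟨ sym (length-++ as) ⟩
  length (as ++ [ f x ] ++ bs)  ∎
  where
  open ≤-Reasoning
  into′ : ∀ {z} → z ∈ xs → f z ∈ as ++ bs
  into′ z∈ with ∈-++⁻ as (into (there z∈))
  ... | inj₁ p = ∈-++⁺ˡ p
  -- A tail element with image `f x` would equal `x`, against uniqueness.
  ... | inj₂ (here eq) = contradiction (inj (here refl) (there z∈) (sym eq)) (All.lookup x≢ z∈)
  ... | inj₂ (there p) = ∈-++⁺ʳ as p

length-⊆ : {xs ys : List A} → Unique xs → (∀ {x} → x ∈ xs → x ∈ ys) → length xs ≤ length ys
length-⊆ u sub = length-injection id u sub (λ _ _ eq → eq)

length-cartesianProductWith : (f : A → B → C) (xs : List A) (ys : List B) →
  length (cartesianProductWith f xs ys) ≡ length xs * length ys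
length-cartesianProductWith f [] ys = refl
length-cartesianProductWith f (x ∷ xs) ys = trans (length-++ (map (f x) ys))
  (cong₂ _+_ (length-map (f x) ys) (length-cartesianProductWith f xs ys))

length-concat-tabulate : ∀ {K} (g : Fin n → List A) → (∀ i → K ≤ length (g i)) →
  n * K ≤ length (concat (tabulate g))
length-concat-tabulate {n = zero} g h = z≤n
length-concat-tabulate {n = suc n} g h =
  ≤-trans (+-mono-≤ (h Fin.zero) (length-concat-tabulate (g ∘ Fin.suc) (h ∘ Fin.suc)))
          (≤-reflexive (sym (length-++ (g Fin.zero))))

-- The concatenation of the disjoint lists has no duplicates and lies in `xs`, and `n` times the
-- shortest length is at most the total. Positivity of `n` supplies the default index for `argmin`.
pigeonhole : 0 < n → {xs : List A} {g : Fin n → List A} →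
  (∀ i → Unique (g i)) → (∀ i {x} → x ∈ g i → x ∈ xs) →
  (∀ {i j} → i ≢ j → ∀ {x} → ¬ (x ∈ g i × x ∈ g j)) →
  ∃ λ i → n * length (g i) ≤ length xs
pigeonhole {n} 0<n {xs} {g} uniq sub disj = i , ≤-trans
  (length-concat-tabulate g (λ j → All.lookup (f[argmin]≤f[xs] (fromℕ< 0<n) (allFin n)) (∈-allFin j)))
  (length-⊆ (Uniq.concat⁺ (AllP.tabulate⁺ uniq) (AllPairsP.tabulate⁺ disj)) into)
  where
  i : Fin n
  i = argmin (length ∘ g) (fromℕ< 0<n) (allFin n)
  into : ∀ {x} → x ∈ concat (tabulate g) → x ∈ xs
  into x∈ with ∈-concat⁻′ (tabulate g) x∈
  ... | _ , x∈ys , ys∈ with ∈-tabulate⁻ ys∈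
  ... | j , refl = sub j x∈ys

abstract
  maximizer : (f : A → ℕ) {x : A} {xs : List A} → x ∈ xs →
    ∃ λ m → m ∈ xs × (∀ {y} → y ∈ xs → f y ≤ f m)
  maximizer f {x} {xs} x∈ = argmax f x xs
    , argmax-all f x∈ (All.tabulate id)
    , All.lookup (f[xs]≤f[argmax] x xs)

∈⇒≤foldr-⊔ : ∀ {k} {ks : List ℕ} → k ∈ ks → k ≤ foldr _⊔_ 0 ks
∈⇒≤foldr-⊔ {ks = k ∷ ks} (here refl) = m≤m⊔n k _
∈⇒≤foldr-⊔ {ks = k ∷ ks} (there p) = ≤-trans (∈⇒≤foldr-⊔ p) (m≤n⊔m k _)

πAt≤πP : {P : List (Pt d)} {x : Pt d} → x ∈ P → πAt P x ≤ πP P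
πAt≤πP {P = P} x∈ = ∈⇒≤foldr-⊔ (∈-map⁺ (πAt P) x∈)

-- Points of ℕ^d

≼-ext : {x y : Pt d} → (∀ i → lookup x i ≤ lookup y i) → x ≼ y
≼-ext h = Ext.extensional⇒inductive (Ext.ext h)

≡-ext : {x y : Pt d} → (∀ i → lookup x i ≡ lookup y i) → x ≡ y
≡-ext h = Pointwise-≡⇒≡ (Ext.extensional⇒inductive (Ext.ext h))

_≟ᵖ_ : (x y : Pt d) → Dec (x ≡ y)
_≟ᵖ_ = ≡-dec _≟_

sum-mono : {x y : Pt d} → x ≼ y → sum x ≤ sum y
sum-mono [] = z≤n
sum-mono (p ∷ ps) = +-mono-≤ p (sum-mono ps)

-- The coordinate sum is strictly monotone, so a point maximizing it is order-maximal. This is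
-- applied to vectors of distances and to the peak of a short axis.
≼∧sum≥⇒≡ : {x y : Pt d} → x ≼ y → sum y ≤ sum x → x ≡ y
≼∧sum≥⇒≡ [] _ = refl
≼∧sum≥⇒≡ {x = a ∷ x} {b ∷ y} (p ∷ ps) s = cong₂ _∷_ a≡b (≼∧sum≥⇒≡ ps
  (+-cancelˡ-≤ b _ _ (subst (λ c → b + sum y ≤ c + sum x) a≡b s)))
  where
  a≡b : a ≡ b
  a≡b = ≤-antisym p (+-cancelʳ-≤ (sum x) b a (≤-trans (+-monoʳ-≤ b (sum-mono ps)) s))

mix : {P : Fin d → Set} → Decidable P → (Fin d → ℕ) → (Fin d → ℕ) → Pt d
mix P? f g = Vec.tabulate (λ i → if does (P? i) then f i else g i)

module _ {P : Fin d → Set} (P? : Decidable P) (f g : Fin d → ℕ) where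

  lookup-mix-yes : ∀ {i} → P i → lookup (mix P? f g) i ≡ f i
  lookup-mix-yes {i} p = trans (lookup∘tabulate _ i)
    (cong (λ b → if b then f i else g i) (dec-true (P? i) p))

  lookup-mix-no : ∀ {i} → ¬ P i → lookup (mix P? f g) i ≡ g i
  lookup-mix-no {i} ¬p = trans (lookup∘tabulate _ i)
    (cong (λ b → if b then f i else g i) (dec-false (P? i) ¬p))

  mix-elim : (R : Fin d → ℕ → Set) → (∀ i → P i → R i (f i)) → (∀ i → ¬ P i → R i (g i)) →
    ∀ i → R i (lookup (mix P? f g) i)
  mix-elim R yes! no! i with P? i
  ... | yes p = subst (R i) (sym (lookup-mix-yes p)) (yes! i p)
  ... | no ¬p = subst (R i) (sym (lookup-mix-no ¬p)) (no! i ¬p)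

axis : Fin d → ℕ → Pt d
axis {d} i a = replicate d 0 [ i ]≔ a

lookup-axis : (i : Fin d) (a : ℕ) → lookup (axis i a) i ≡ a
lookup-axis {d} i a = lookup∘update i (replicate d 0) a

lookup-axis-≢ : {i j : Fin d} (a : ℕ) → j ≢ i → lookup (axis i a) j ≡ 0
lookup-axis-≢ {d} {i} {j} a j≢i = trans (lookup∘update′ j≢i (replicate d 0) a) (lookup-replicate j 0)

axis-≼ : {i : Fin d} {a : ℕ} {z : Pt d} → a ≤ lookup z i → axis i a ≼ z
axis-≼ {i = i} {a} {z} h = ≼-ext λ j → go j (j FinP.≟ i)
  where
  go : ∀ j → Dec (j ≡ i) → lookup (axis i a) j ≤ lookup z j
  go j (yes refl) = subst (_≤ lookup z i) (sym (lookup-axis i a)) h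
  go j (no j≢i) = subst (_≤ lookup z j) (sym (lookup-axis-≢ a j≢i)) z≤n

box : Pt d → List (Pt d)
box [] = [ [] ]
box (a ∷ x) = cartesianProductWith _∷_ (upTo (suc a)) (box x)

∈-box : {x z : Pt d} → z ≼ x → z ∈ box x
∈-box [] = here refl
∈-box (p ∷ ps) = ∈-cartesianProductWith⁺ _∷_ (∈-upTo⁺ (s≤s p)) (∈-box ps)

length-box : ∀ {K} (x : Pt d) → (∀ i → lookup x i < K) → length (box x) ≤ K ^ d
length-box [] h = ≤-refl
length-box {K = K} (a ∷ x) h = ≤-trans
  (≤-reflexive (trans (length-cartesianProductWith _∷_ (upTo (suc a)) (box x))
                      (cong (_* length (box x)) (length-upTo (suc a)))))
  (*-mono-≤ (h Fin.zero) (length-box x (h ∘ Fin.suc)))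

-- Convex sets

module Convexity {P : List (Pt d)} (convex : Convex P) where

  between : ∀ {x y z} → x ∈ P → z ∈ P → x ≼ y → y ≼ z → y ∈ P
  between {x} {y} {z} x∈ z∈ x≼y y≼z with x ≟ᵖ y | y ≟ᵖ z
  ... | yes refl | _ = x∈
  ... | no _ | yes refl = z∈
  ... | no x≢y | no y≢z = convex x y z x∈ z∈ (x≼y , x≢y) (y≼z , y≢z)

  -- The L¹ distance is the sum of this vector; keeping the vector lets equality of totals be turned
  -- into equality in every coordinate.
  dist : Pt d → Pt d → Pt d
  dist = zipWith ∣_-_∣

  Widest : Pt d → Pt d → Set
  Widest x y = x ∈ P × y ∈ P × Incomparable x y ×
    (∀ {x′ y′} → x′ ∈ P → y′ ∈ P → Incomparable x′ y′ → sum (dist x′ y′) ≤ sum (dist x y))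

  ∃-widest : ¬ IsChain P → ∃ λ x → ∃ λ y → Widest x y
  ∃-widest ¬chain = go pairs refl
    where
    inc? : Decidable (λ (xy : Pt d × Pt d) → Incomparable (proj₁ xy) (proj₂ xy))
    inc? (x , y) = incomparable? x y
    pairs : List (Pt d × Pt d)
    pairs = filter inc? (cartesianProduct P P)
    in-pairs : ∀ {x y} → x ∈ P → y ∈ P → Incomparable x y → (x , y) ∈ pairs
    in-pairs x∈ y∈ i = ∈-filter⁺ inc? (∈-cartesianProduct⁺ x∈ y∈) i
    go : ∀ ps → ps ≡ pairs → ∃ λ x → ∃ λ y → Widest x y
    -- With no incomparable pair, `P` would be a chain, since comparability is decidable.
    go [] eq = contradiction (λ x y x∈ y∈ → decidable-stable ((x ≼? y) ⊎-dec (y ≼? x))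
      (λ i → contradiction (subst ((x , y) ∈_) (sym eq) (in-pairs x∈ y∈ i)) λ ())) ¬chain
    go (p ∷ ps) eq with maximizer (λ (x , y) → sum (dist x y)) (subst (p ∈_) eq (here refl))
    ... | (x , y) , xy∈ , max with ∈-filter⁻ inc? xy∈
    ... | xy∈′ , i with ∈-cartesianProduct⁻ P P xy∈′
    ... | x∈ , y∈ = x , y , x∈ , y∈ , i , λ x∈ y∈ i → max (in-pairs x∈ y∈ i)

  module _ {x y : Pt d} (w : Widest x y) where

    private
      x∈ = proj₁ w
      y∈ = proj₁ (proj₂ w)
      x∥y = proj₁ (proj₂ (proj₂ w))
      widest = proj₂ (proj₂ (proj₂ w))

    -- A widening moves `x` up and `y` down in these coordinates, ties included, and does the
    -- reverse in the others.
    Low : Fin d → Set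
    Low i = lookup y i ≤ lookup x i

    low? : Decidable Low
    low? i = lookup y i ≤? lookup x i

    module _ {x′ y′ : Pt d} (x′∈ : x′ ∈ P) (y′∈ : y′ ∈ P)
      (low : ∀ i → Low i → lookup x i ≤ lookup x′ i × lookup y′ i ≤ lookup y i)
      (high : ∀ i → ¬ Low i → lookup x′ i ≤ lookup x i × lookup y i ≤ lookup y′ i) where

      -- If `x′ ≼ y′`, then x ≤ x′ ≤ y′ ≤ y in the `Low` coordinates, while x < y already holds in
      -- the others, so `x ≼ y`. The other case is dual.
      widening-incomparable : Incomparable x′ y′
      widening-incomparable (inj₁ x′≼y′) = x∥y (inj₁ (≼-ext λ i → go i (low? i)))
        where
        go : ∀ i → Dec (Low i) → lookup x i ≤ lookup y i
        go i (yes l) = ≤-trans (proj₁ (low i l)) (≤-trans (PW.lookup x′≼y′ i) (proj₂ (low i l)))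
        go i (no h) = <⇒≤ (≰⇒> h)
      widening-incomparable (inj₂ y′≼x′) = x∥y (inj₂ (≼-ext λ i → go i (low? i)))
        where
        go : ∀ i → Dec (Low i) → lookup y i ≤ lookup x i
        go i (yes l) = l
        go i (no h) = ≤-trans (proj₂ (high i h)) (≤-trans (PW.lookup y′≼x′ i) (proj₁ (high i h)))

      -- Widening shrinks no coordinate distance, and the total is already maximal, so each distance
      -- is unchanged. Nested intervals of equal length coincide.
      widening-trivial : ∀ i → lookup x′ i ≡ lookup x i × lookup y′ i ≡ lookup y i
      widening-trivial i = go (low? i)
        where
        nested : ∀ {a b a′ b′} → a ≤ b → a′ ≤ a → b ≤ b′ → ∣ b - a ∣ ≤ ∣ b′ - a′ ∣
        nested {a} {b} {a′} {b′} a≤b a′≤a b≤b′ = subst₂ _≤_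
          (sym (m≤n⇒∣n-m∣≡n∸m a≤b)) (sym (m≤n⇒∣n-m∣≡n∸m (≤-trans a′≤a (≤-trans a≤b b≤b′))))
          (∸-mono b≤b′ a′≤a)
        nested-≡ : ∀ {a b a′ b′} → a ≤ b → a′ ≤ a → b ≤ b′ → ∣ b - a ∣ ≡ ∣ b′ - a′ ∣ → b′ ≡ b × a′ ≡ a
        nested-≡ {a} {b} {a′} {b′} a≤b a′≤a b≤b′ eq = b′≡b , ∸-cancelˡ-≡ a′≤b a≤b (trans
          (cong (_∸ a′) (sym b′≡b)) (sym eq′))
          where
          a′≤b = ≤-trans a′≤a a≤b
          eq′ : b ∸ a ≡ b′ ∸ a′
          eq′ = trans (sym (m≤n⇒∣n-m∣≡n∸m a≤b)) (trans eq (m≤n⇒∣n-m∣≡n∸m (≤-trans a′≤b b≤b′)))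
          b′≡b : b′ ≡ b
          b′≡b = ≤-antisym (≮⇒≥ λ b<b′ → <-irrefl eq′
            (≤-<-trans (∸-monoʳ-≤ b a′≤a) (∸-monoˡ-< b<b′ a′≤b))) b≤b′
        flip : ∀ {a b a′ b′} → ∣ b - a ∣ ≤ ∣ b′ - a′ ∣ → ∣ a - b ∣ ≤ ∣ a′ - b′ ∣
        flip {a} {b} {a′} {b′} = subst₂ _≤_ (∣-∣-comm b a) (∣-∣-comm b′ a′)
        dist-lookup : ∀ (u v : Pt d) j → lookup (dist u v) j ≡ ∣ lookup u j - lookup v j ∣
        dist-lookup u v j = lookup-zipWith ∣_-_∣ j u v
        wider : ∀ j → Dec (Low j) → ∣ lookup x j - lookup y j ∣ ≤ ∣ lookup x′ j - lookup y′ j ∣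
        wider j (yes l) = nested l (proj₂ (low j l)) (proj₁ (low j l))
        wider j (no h) = flip {lookup x j} {lookup y j} {lookup x′ j}
          (nested (<⇒≤ (≰⇒> h)) (proj₁ (high j h)) (proj₂ (high j h)))
        same : dist x y ≡ dist x′ y′
        same = ≼∧sum≥⇒≡
          (≼-ext λ j → subst₂ _≤_ (sym (dist-lookup x y j)) (sym (dist-lookup x′ y′ j)) (wider j (low? j)))
          (widest x′∈ y′∈ widening-incomparable)
        same-i : ∣ lookup x i - lookup y i ∣ ≡ ∣ lookup x′ i - lookup y′ i ∣
        same-i = trans (sym (dist-lookup x y i)) (trans (cong (λ v → lookup v i) same) (dist-lookup x′ y′ i))
        go : Dec (Low i) → lookup x′ i ≡ lookup x i × lookup y′ i ≡ lookup y i
        go (yes l) = nested-≡ l (proj₂ (low i l)) (proj₁ (low i l)) same-i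
        go (no h) with nested-≡ (<⇒≤ (≰⇒> h)) (proj₁ (high i h)) (proj₂ (high i h))
          (trans (∣-∣-comm (lookup y i) _) (trans same-i (∣-∣-comm (lookup x′ i) _)))
        ... | p , q = q , p

    upper-bound-unique : ∀ {u} → u ∈ P → x ≼ u → y ≼ u → u ≡ zipWith _⊔_ x y
    upper-bound-unique {u} u∈ x≼u y≼u = ≡-ext λ i → trans (u-at i (low? i)) (sym (lookup-zipWith _⊔_ i x y))
      where
      -- In each coordinate the larger of `x` and `y` is raised to `u`. Both new points stay below
      -- `u`, so convexity keeps them in `P`.
      x′ = mix low? (lookup u) (lookup x)
      y′ = mix low? (lookup y) (lookup u)
      x≤u = PW.lookup x≼u
      y≤u = PW.lookup y≼u
      x′∈ : x′ ∈ P
      x′∈ = between x∈ u∈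
        (≼-ext (mix-elim low? _ _ (λ i c → lookup x i ≤ c) (λ i _ → x≤u i) (λ _ _ → ≤-refl)))
        (≼-ext (mix-elim low? _ _ (λ i c → c ≤ lookup u i) (λ _ _ → ≤-refl) (λ i _ → x≤u i)))
      y′∈ : y′ ∈ P
      y′∈ = between y∈ u∈
        (≼-ext (mix-elim low? _ _ (λ i c → lookup y i ≤ c) (λ _ _ → ≤-refl) (λ i _ → y≤u i)))
        (≼-ext (mix-elim low? _ _ (λ i c → c ≤ lookup u i) (λ i _ → y≤u i) (λ _ _ → ≤-refl)))
      trivial : ∀ i → lookup x′ i ≡ lookup x i × lookup y′ i ≡ lookup y i
      trivial = widening-trivial x′∈ y′∈
        (λ i l → ≤-trans (x≤u i) (≤-reflexive (sym (lookup-mix-yes low? _ _ l)))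
               , ≤-reflexive (lookup-mix-yes low? _ _ l))
        (λ i h → ≤-reflexive (lookup-mix-no low? _ _ h)
               , ≤-trans (y≤u i) (≤-reflexive (sym (lookup-mix-no low? _ _ h))))
      u-at : ∀ i → Dec (Low i) → lookup u i ≡ lookup x i ⊔ lookup y i
      u-at i (yes l) = trans (sym (lookup-mix-yes low? _ _ l))
        (trans (proj₁ (trivial i)) (sym (m≥n⇒m⊔n≡m l)))
      u-at i (no h) = trans (sym (lookup-mix-no low? _ _ h))
        (trans (proj₂ (trivial i)) (sym (m≤n⇒m⊔n≡n (<⇒≤ (≰⇒> h)))))

    lower-bound-unique : ∀ {u} → u ∈ P → u ≼ x → u ≼ y → u ≡ zipWith _⊓_ x y
    lower-bound-unique {u} u∈ u≼x u≼y = ≡-ext λ i → trans (u-at i (low? i)) (sym (lookup-zipWith _⊓_ i x y))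
      where
      -- Dually, the smaller of `x` and `y` is lowered to `u` in each coordinate.
      x′ = mix low? (lookup x) (lookup u)
      y′ = mix low? (lookup u) (lookup y)
      u≤x = PW.lookup u≼x
      u≤y = PW.lookup u≼y
      x′∈ : x′ ∈ P
      x′∈ = between u∈ x∈
        (≼-ext (mix-elim low? _ _ (λ i c → lookup u i ≤ c) (λ i _ → u≤x i) (λ _ _ → ≤-refl)))
        (≼-ext (mix-elim low? _ _ (λ i c → c ≤ lookup x i) (λ _ _ → ≤-refl) (λ i _ → u≤x i)))
      y′∈ : y′ ∈ P
      y′∈ = between u∈ y∈
        (≼-ext (mix-elim low? _ _ (λ i c → lookup u i ≤ c) (λ _ _ → ≤-refl) (λ i _ → u≤y i)))
        (≼-ext (mix-elim low? _ _ (λ i c → c ≤ lookup y i) (λ i _ → u≤y i) (λ _ _ → ≤-refl)))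
      trivial : ∀ i → lookup x′ i ≡ lookup x i × lookup y′ i ≡ lookup y i
      trivial = widening-trivial x′∈ y′∈
        (λ i l → ≤-reflexive (sym (lookup-mix-yes low? _ _ l))
               , ≤-trans (≤-reflexive (lookup-mix-yes low? _ _ l)) (u≤y i))
        (λ i h → ≤-trans (≤-reflexive (lookup-mix-no low? _ _ h)) (u≤x i)
               , ≤-reflexive (sym (lookup-mix-no low? _ _ h)))
      u-at : ∀ i → Dec (Low i) → lookup u i ≡ lookup x i ⊓ lookup y i
      u-at i (yes l) = trans (sym (lookup-mix-yes low? _ _ l))
        (trans (proj₂ (trivial i)) (sym (m≥n⇒m⊓n≡n l)))
      u-at i (no h) = trans (sym (lookup-mix-no low? _ _ h))
        (trans (proj₁ (trivial i)) (sym (m≤n⇒m⊓n≡m (<⇒≤ (≰⇒> h)))))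

    length≤πAt+πAt+2 : Unique P → length P ≤ πAt P x + (πAt P y + 2)
    length≤πAt+πAt+2 uniq = ≤-trans (length-⊆ uniq cover) (≤-reflexive
      (trans (length-++ (filter (incomparable? x) P)) (cong (πAt P x +_) (length-++ (filter (incomparable? y) P)))))
      where
      bounds : List (Pt d)
      bounds = zipWith _⊔_ x y ∷ zipWith _⊓_ x y ∷ []
      cover : ∀ {z} → z ∈ P → z ∈ filter (incomparable? x) P ++ filter (incomparable? y) P ++ bounds
      cover {z} z∈ with incomparable? x z | incomparable? y z
      ... | yes i | _ = ∈-++⁺ˡ (∈-filter⁺ (incomparable? x) z∈ i)
      ... | no _ | yes j = ∈-++⁺ʳ (filter (incomparable? x) P) (∈-++⁺ˡ (∈-filter⁺ (incomparable? y) z∈ j))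
      ... | no ¬i | no ¬j = ∈-++⁺ʳ (filter (incomparable? x) P) (∈-++⁺ʳ (filter (incomparable? y) P)
        (go (decidable-stable ((x ≼? z) ⊎-dec (z ≼? x)) ¬i) (decidable-stable ((y ≼? z) ⊎-dec (z ≼? y)) ¬j)))
        where
        go : x ≼ z ⊎ z ≼ x → y ≼ z ⊎ z ≼ y → z ∈ bounds
        go (inj₁ a) (inj₁ b) = here (upper-bound-unique z∈ a b)
        go (inj₂ a) (inj₂ b) = there (here (lower-bound-unique z∈ a b))
        -- A point between `x` and `y` would make them comparable.
        go (inj₁ a) (inj₂ b) = ⊥-elim (x∥y (inj₁ (PW.trans ≤-trans a b)))
        go (inj₂ a) (inj₁ b) = ⊥-elim (x∥y (inj₂ (PW.trans ≤-trans b a)))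

convex-bound : {P : List (Pt d)} → Unique P → Convex P → ¬ IsChain P → length P ≤ 2 * πP P + 2
convex-bound {P = P} uniq convex ¬chain with Convexity.∃-widest convex ¬chain
... | x , y , w@(x∈ , y∈ , _) = begin
  length P                    ≤⟨ Convexity.length≤πAt+πAt+2 convex w uniq ⟩
  πAt P x + (πAt P y + 2)     ≤⟨ +-mono-≤ (πAt≤πP x∈) (+-monoˡ-≤ 2 (πAt≤πP y∈)) ⟩
  πP P + (πP P + 2)           ≡⟨ rearrange (πP P) ⟩
  2 * πP P + 2                ∎
  where
  open ≤-Reasoning
  rearrange : ∀ p → p + (p + 2) ≡ 2 * p + 2
  rearrange = solve-∀

-- Ideals

-- One constant for both kinds of axis: `d + d * d` covers the trade-off on a long axis, `d * d ^ d`
-- the box below the peak of a short one.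
ideal-slack : ℕ → ℕ
ideal-slack d = d + d * d + d * d ^ d

-- With m = suc a: trivial for U ≤ d, and otherwise it is (U − d)(m − d) ≥ 0.
trade-off : ∀ {d a c D U N} → d ≤ suc a → d * c ≤ N → D ≤ suc a → D ≤ suc c → U * suc a ≤ N →
  d * (D + U) ≤ N + ideal-slack d
trade-off {d} {a} {c} {D} {U} {N} d≤m dc≤N D≤m D≤c Um≤N with U ≤? d
... | yes U≤d = begin
  d * (D + U)                      ≤⟨ *-monoʳ-≤ d (+-mono-≤ D≤c U≤d) ⟩
  d * (suc c + d)                  ≡⟨ e₁ d c ⟩
  d * c + (d + d * d)              ≤⟨ +-mono-≤ dc≤N (m≤m+n _ _) ⟩
  N + ideal-slack d                ∎
  where
  open ≤-Reasoning
  e₁ : ∀ d c → d * (suc c + d) ≡ d * c + (d + d * d)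
  e₁ = solve-∀
... | no U≰d with m≤n⇒∃[o]m+o≡n (<⇒≤ (≰⇒> U≰d)) | m≤n⇒∃[o]m+o≡n d≤m
... | u , refl | v , d+v≡m = begin
  d * (D + (d + u))                ≤⟨ *-monoʳ-≤ d (+-monoˡ-≤ (d + u) D≤m) ⟩
  d * (suc a + (d + u))            ≡⟨ cong (λ m → d * (m + (d + u))) (sym d+v≡m) ⟩
  d * (d + v + (d + u))            ≤⟨ m≤m+n _ (u * v) ⟩
  d * (d + v + (d + u)) + u * v    ≡⟨ e₂ d u v ⟩
  (d + u) * (d + v) + d * d        ≡⟨ cong (λ m → (d + u) * m + d * d) d+v≡m ⟩
  (d + u) * suc a + d * d          ≤⟨ +-mono-≤ Um≤N (≤-trans (m≤n+m (d * d) d) (m≤m+n _ _)) ⟩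
  N + ideal-slack d                ∎
  where
  open ≤-Reasoning
  e₂ : ∀ d u v → d * (d + v + (d + u)) + u * v ≡ (d + u) * (d + v) + d * d
  e₂ = solve-∀

module Ideal {d : ℕ} {P : List (Pt d)} (0<d : 0 < d) (uniq : Unique P) (ideal : IsIdeal P)
  (spanning : ¬ InCoordHyperplane P) where

  downward : ∀ {x y} → x ≼ y → y ∈ P → x ∈ P
  downward {x} {y} x≼y y∈ with x ≟ᵖ y
  ... | yes refl = y∈
  ... | no x≢y = ideal x y (x≼y , x≢y) y∈

  nonempty : ∃ λ x → x ∈ P
  nonempty = go P refl
    where
    go : ∀ xs → xs ≡ P → ∃ λ x → x ∈ P
    -- The empty set lies in every coordinate hyperplane, and `0<d` provides one.
    go [] eq = contradiction (fromℕ< 0<d , λ x x∈ → contradiction (subst (x ∈_) (sym eq) x∈) λ ()) spanning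
    go (x ∷ xs) eq = x , subst (x ∈_) eq (here refl)

  extreme : ∀ i → ∃ λ t → t ∈ P × (∀ {z} → z ∈ P → lookup z i ≤ lookup t i)
  extreme i = maximizer (λ z → lookup z i) (proj₂ nonempty)

  extent : Fin d → ℕ
  extent i = lookup (proj₁ (extreme i)) i

  lookup≤extent : ∀ i {z} → z ∈ P → lookup z i ≤ extent i
  lookup≤extent i = proj₂ (proj₂ (extreme i))

  axis∈ : ∀ {i a} → a ≤ extent i → axis i a ∈ P
  axis∈ {i} a≤ = downward (axis-≼ a≤) (proj₁ (proj₂ (extreme i)))

  0<extent : ∀ i → 0 < extent i
  0<extent i = n≢0⇒n>0 λ eq → spanning (i , λ x x∈ → n≤0⇒n≡0 (subst (lookup x i ≤_) eq (lookup≤extent i x∈)))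

  -- `suc (extent i)` counts the points of `P` on the axis, origin included, and equally the layers
  -- of `P` orthogonal to it.
  Short : Fin d → Set
  Short i = suc (extent i) < d

  short? : Decidable Short
  short? i = suc (extent i) <? d

  -- On a long axis i these are the nonzero points of that axis; for short i they
  -- are the points whose short coordinates form the unit vector of i.
  Cell : Fin d → Pt d → Set
  Cell i z = lookup z i ≢ 0 × (Short i → lookup z i ≤ 1) ×
    (∀ j → j ≢ i → Short j ⊎ ¬ Short i → lookup z j ≡ 0)

  cell? : ∀ i → Decidable (Cell i)
  cell? i z = ¬? (lookup z i ≟ 0) ×-dec (short? i →-dec (lookup z i ≤? 1)) ×-dec
    FinP.all? (λ j → ¬? (j FinP.≟ i) →-dec ((short? j ⊎-dec ¬? (short? i)) →-dec (lookup z j ≟ 0)))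

  cell : Fin d → List (Pt d)
  cell i = filter (cell? i) P

  -- If `i` is short, points of `cell j` vanish at `i`. If `i` is long, points of `cell i` lie on
  -- its axis and vanish at `j`.
  cells-disjoint : ∀ {i j} → i ≢ j → ∀ {z} → ¬ (z ∈ cell i × z ∈ cell j)
  cells-disjoint {i} {j} i≢j {z} (p , q)
    with proj₂ (∈-filter⁻ (cell? i) {xs = P} p) | proj₂ (∈-filter⁻ (cell? j) {xs = P} q) | short? i
  ... | zi≢0 , _ , _ | _ , _ , zero-off-j | yes s = zi≢0 (zero-off-j i i≢j (inj₁ s))
  ... | _ , _ , zero-off-i | zj≢0 , _ , _ | no ¬s = zj≢0 (zero-off-i j (≢-sym i≢j) (inj₂ ¬s))

  ∃-small-cell : ∃ λ i → d * length (cell i) ≤ length P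
  ∃-small-cell = pigeonhole 0<d {g = cell} (λ i → Uniq.filter⁺ (cell? i) uniq)
    (λ i → proj₁ ∘ ∈-filter⁻ (cell? i) {xs = P}) cells-disjoint

  below above : Pt d → List (Pt d)
  below x = filter (_≼? x) P
  above x = filter (x ≼?_) P

  -- The three lists cover `P`. For `x ∈ P` the last two share `x`, which only enlarges the sum.
  length≤πAt+below+above : ∀ x → length P ≤ πAt P x + (length (below x) + length (above x))
  length≤πAt+below+above x = ≤-trans (length-⊆ uniq cover) (≤-reflexive
    (trans (length-++ (filter (incomparable? x) P)) (cong (πAt P x +_) (length-++ (below x)))))
    where
    cover : ∀ {z} → z ∈ P → z ∈ filter (incomparable? x) P ++ below x ++ above x
    cover {z} z∈ with incomparable? x z | z ≼? x | x ≼? z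
    ... | yes i | _ | _ = ∈-++⁺ˡ (∈-filter⁺ (incomparable? x) z∈ i)
    ... | no _ | yes p | _ = ∈-++⁺ʳ (filter (incomparable? x) P) (∈-++⁺ˡ (∈-filter⁺ (_≼? x) z∈ p))
    ... | no _ | no _ | yes q = ∈-++⁺ʳ (filter (incomparable? x) P) (∈-++⁺ʳ (below x) (∈-filter⁺ (x ≼?_) z∈ q))
    ... | no ¬i | no ¬p | no ¬q = contradiction [ ¬q , ¬p ]′ ¬i

  FewComparable : Pt d → Set
  FewComparable x = d * (length (below x) + length (above x)) ≤ length P + ideal-slack d

  -- Long axes: the tip of the axis

  module LongAxis (i : Fin d) (long : ¬ Short i) (small : d * length (cell i) ≤ length P) where

    tip : Pt d
    tip = axis i (extent i)

    off-axis : ∀ {z} → z ≼ tip → ∀ j → j ≢ i → lookup z j ≡ 0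
    off-axis {z} z≼ j j≢i = n≤0⇒n≡0 (subst (lookup z j ≤_) (lookup-axis-≢ _ j≢i) (PW.lookup z≼ j))

    on-axis-≡ : ∀ {y z} → y ≼ tip → z ≼ tip → lookup y i ≡ lookup z i → y ≡ z
    on-axis-≡ {y} {z} y≼ z≼ eq = ≡-ext λ j → go j (j FinP.≟ i)
      where
      go : ∀ j → Dec (j ≡ i) → lookup y j ≡ lookup z j
      go j (yes refl) = eq
      go j (no j≢i) = trans (off-axis y≼ j j≢i) (sym (off-axis z≼ j j≢i))

    below-tip : ∀ {z} → z ∈ below tip → z ∈ P × z ≼ tip
    below-tip = ∈-filter⁻ (_≼? tip)

    -- Points below the tip lie on the axis, so their `i`-th coordinate determines them. The
    -- trade-off uses this bound when more than `d` points lie above the tip, and `below≤cell`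
    -- otherwise.
    below≤extent : length (below tip) ≤ suc (extent i)
    below≤extent = subst (length (below tip) ≤_) (length-upTo (suc (extent i)))
      (length-injection (λ z → lookup z i) (Uniq.filter⁺ (_≼? tip) uniq)
        (λ z∈ → ∈-upTo⁺ (s≤s (lookup≤extent i (proj₁ (below-tip z∈)))))
        (λ y∈ z∈ → on-axis-≡ (proj₂ (below-tip y∈)) (proj₂ (below-tip z∈))))

    -- The `suc` accounts for the origin, the one point below the tip outside the cell.
    below≤cell : length (below tip) ≤ suc (length (cell i))
    below≤cell = length-⊆ (Uniq.filter⁺ (_≼? tip) uniq) into
      where
      into : ∀ {z} → z ∈ below tip → z ∈ axis i 0 ∷ cell i
      into {z} z∈ with below-tip z∈ | lookup z i ≟ 0
      ... | _ , z≼ | yes eq = here (on-axis-≡ z≼ (axis-≼ z≤n)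
                                     (trans eq (sym (lookup-axis i 0))))
      ... | z∈P , z≼ | no zi≢0 = there (∈-filter⁺ (cell? i) z∈P
        (zi≢0 , (λ s → contradiction s long) , λ j j≢i _ → off-axis z≼ j j≢i))

    above-coord : ∀ {z} → z ∈ above tip → lookup z i ≡ extent i
    above-coord z∈ with ∈-filter⁻ (tip ≼?_) z∈
    ... | z∈P , tip≼z = ≤-antisym (lookup≤extent i z∈P)
      (≤-trans (≤-reflexive (sym (lookup-axis i _))) (PW.lookup tip≼z i))

    -- All layers orthogonal to the axis contain a translate of the top one.
    above-layers : length (above tip) * suc (extent i) ≤ length P
    above-layers = subst (_≤ length P)
      (trans (length-cartesianProductWith _,_ (above tip) _) (cong (length (above tip) *_) (length-upTo _)))
      (length-injection set (Uniq.cartesianProduct⁺ (Uniq.filter⁺ (tip ≼?_) uniq) (Uniq.upTo⁺ (suc (extent i))))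
        into inj)
      where
      grid : List (Pt d × ℕ)
      grid = cartesianProduct (above tip) (upTo (suc (extent i)))
      set : Pt d × ℕ → Pt d
      set (z , k) = z [ i ]≔ k
      split : ∀ {zk} → zk ∈ grid → proj₁ zk ∈ above tip × proj₂ zk ∈ upTo (suc (extent i))
      split = ∈-cartesianProduct⁻ (above tip) (upTo (suc (extent i)))
      set-≼ : ∀ {z k} → k ≤ lookup z i → set (z , k) ≼ z
      set-≼ {z} {k} k≤ = ≼-ext λ j → go j (j FinP.≟ i)
        where
        go : ∀ j → Dec (j ≡ i) → lookup (z [ i ]≔ k) j ≤ lookup z j
        go j (yes refl) = ≤-trans (≤-reflexive (lookup∘update i z k)) k≤
        go j (no j≢i) = ≤-reflexive (lookup∘update′ j≢i z k)
      into : ∀ {zk} → zk ∈ grid → set zk ∈ P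
      into {z , k} zk∈ with split zk∈
      ... | z∈ , k∈ = downward
        (set-≼ (subst (k ≤_) (sym (above-coord z∈)) (≤-pred (∈-upTo⁻ k∈))))
        (proj₁ (∈-filter⁻ (tip ≼?_) z∈))
      -- `k` is read off at coordinate `i`, where all points above the tip agree; the other
      -- coordinates of `z` are untouched.
      inj : ∀ {zk wl} → zk ∈ grid → wl ∈ grid → set zk ≡ set wl → zk ≡ wl
      inj {z , k} {w , l} zk∈ wl∈ eq = cong₂ _,_ (≡-ext λ j → go j (j FinP.≟ i))
        (trans (sym (lookup∘update i z k)) (trans (cong (λ v → lookup v i) eq) (lookup∘update i w l)))
        where
        go : ∀ j → Dec (j ≡ i) → lookup z j ≡ lookup w j
        go j (yes refl) = trans (above-coord (proj₁ (split zk∈))) (sym (above-coord (proj₁ (split wl∈))))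
        go j (no j≢i) = trans (sym (lookup∘update′ j≢i z k))
          (trans (cong (λ v → lookup v j) eq) (lookup∘update′ j≢i w l))

    few-comparable : FewComparable tip
    few-comparable = trade-off (≮⇒≥ long) small below≤extent below≤cell above-layers

  -- Short axes: a maximal point supported on the short coordinates

  module ShortAxis (i : Fin d) (short : Short i) (small : d * length (cell i) ≤ length P) where

    Supported : Pt d → Set
    Supported z = lookup z i ≢ 0 × (∀ j → ¬ Short j → lookup z j ≡ 0)

    supported? : Decidable Supported
    supported? z = ¬? (lookup z i ≟ 0) ×-dec
      FinP.all? (λ j → ¬? (short? j) →-dec (lookup z j ≟ 0))

    unit-supported : axis i 1 ∈ filter supported? P
    unit-supported = ∈-filter⁺ supported? (axis∈ (0<extent i))
      ( (λ eq → contradiction (trans (sym (lookup-axis i 1)) eq) λ ())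
      , λ j ¬s → lookup-axis-≢ {i = i} 1 λ { refl → ¬s short })

    ∃-peak : ∃ λ w → w ∈ filter supported? P × (∀ {z} → z ∈ filter supported? P → sum z ≤ sum w)
    ∃-peak = maximizer sum unit-supported

    peak : Pt d
    peak = proj₁ ∃-peak

    peak∈ : peak ∈ P
    peak∈ = proj₁ (∈-filter⁻ supported? (proj₁ (proj₂ ∃-peak)))

    peak-supported : Supported peak
    peak-supported = proj₂ (∈-filter⁻ supported? {xs = P} (proj₁ (proj₂ ∃-peak)))

    lookup-peak<d : ∀ j → lookup peak j < d
    lookup-peak<d j with short? j
    ... | yes s = <-trans (s≤s (lookup≤extent j peak∈)) s
    ... | no ¬s = subst (_< d) (sym (proj₂ peak-supported j ¬s)) 0<d

    below-peak : length (below peak) ≤ d ^ d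
    below-peak = ≤-trans
      (length-⊆ (Uniq.filter⁺ (_≼? peak) uniq) (∈-box ∘ proj₂ ∘ ∈-filter⁻ (_≼? peak) {xs = P}))
      (length-box peak lookup-peak<d)

    -- Zeroing the long coordinates of `z` gives a supported point of `P` still above the peak. By
    -- maximality of the sum it is the peak.
    above-peak-coord : ∀ {z} → z ∈ above peak → ∀ j → Short j → lookup z j ≡ lookup peak j
    above-peak-coord {z} z∈ j s with ∈-filter⁻ (peak ≼?_) z∈
    ... | z∈P , peak≼z = trans (sym (lookup-mix-yes short? _ _ s)) (cong (λ v → lookup v j) (sym peak≡))
      where
      shadow : Pt d
      shadow = mix short? (lookup z) (λ _ → 0)
      peak≼shadow : peak ≼ shadow
      peak≼shadow = ≼-ext (mix-elim short? _ _ (λ k c → lookup peak k ≤ c)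
        (λ k _ → PW.lookup peak≼z k) (λ k ¬s → ≤-reflexive (proj₂ peak-supported k ¬s)))
      shadow∈ : shadow ∈ P
      shadow∈ = downward (≼-ext (mix-elim short? _ _ (λ k c → c ≤ lookup z k)
        (λ _ _ → ≤-refl) (λ _ _ → z≤n))) z∈P
      peak≡ : peak ≡ shadow
      peak≡ = ≼∧sum≥⇒≡ peak≼shadow (proj₂ (proj₂ ∃-peak) (∈-filter⁺ supported? shadow∈
        ( (λ eq → proj₁ peak-supported (n≤0⇒n≡0 (subst (lookup peak i ≤_) eq (PW.lookup peak≼shadow i))))
        , λ k ¬s → lookup-mix-no short? _ _ ¬s)))

    -- Points above the peak share their short coordinates, so overwriting these by a unit vector
    -- loses no information.
    above-peak : length (above peak) ≤ length (cell i)
    above-peak = length-injection drop (Uniq.filter⁺ (peak ≼?_) uniq) into inj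
      where
      drop : Pt d → Pt d
      drop z = mix short? (lookup (axis i 1)) (lookup z)
      drop-i : ∀ z → lookup (drop z) i ≡ 1
      drop-i z = trans (lookup-mix-yes short? _ _ short) (lookup-axis i 1)
      into : ∀ {z} → z ∈ above peak → drop z ∈ cell i
      into {z} z∈ with ∈-filter⁻ (peak ≼?_) z∈
      ... | z∈P , peak≼z = ∈-filter⁺ (cell? i) (downward drop≼ z∈P)
        ( (λ eq → contradiction (trans (sym (drop-i z)) eq) λ ())
        , (λ _ → ≤-reflexive (drop-i z))
        , λ { j j≢i (inj₁ s) → trans (lookup-mix-yes short? _ _ s) (lookup-axis-≢ 1 j≢i)
            ; j j≢i (inj₂ ¬s) → contradiction short ¬s })
        where
        unit≼ : axis i 1 ≼ z
        -- The peak is nonzero at `i`, so `z` dominates the unit vector and the overwriting only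
        -- lowers `z`.
        unit≼ = axis-≼ (≤-trans (n≢0⇒n>0 (proj₁ peak-supported)) (PW.lookup peak≼z i))
        drop≼ : drop z ≼ z
        drop≼ = ≼-ext (mix-elim short? _ _ (λ k c → c ≤ lookup z k) (λ k _ → PW.lookup unit≼ k) (λ _ _ → ≤-refl))
      inj : ∀ {y z} → y ∈ above peak → z ∈ above peak → drop y ≡ drop z → y ≡ z
      inj {y} {z} y∈ z∈ eq = ≡-ext λ j → go j (short? j)
        where
        go : ∀ j → Dec (Short j) → lookup y j ≡ lookup z j
        go j (yes s) = trans (above-peak-coord y∈ j s) (sym (above-peak-coord z∈ j s))
        go j (no ¬s) = trans (sym (lookup-mix-no short? _ _ ¬s))
          (trans (cong (λ v → lookup v j) eq) (lookup-mix-no short? _ _ ¬s))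

    few-comparable : FewComparable peak
    few-comparable = begin
      d * (length (below peak) + length (above peak))  ≤⟨ *-monoʳ-≤ d (+-mono-≤ below-peak above-peak) ⟩
      d * (d ^ d + length (cell i))                    ≡⟨ *-distribˡ-+ d (d ^ d) _ ⟩
      d * d ^ d + d * length (cell i)                  ≤⟨ +-mono-≤ (m≤n+m _ (d + d * d)) small ⟩
      ideal-slack d + length P                         ≡⟨ +-comm (ideal-slack d) (length P) ⟩
      length P + ideal-slack d                         ∎
      where open ≤-Reasoning

  abstract
    ∃-few-comparable : ∃ λ x → x ∈ P × FewComparable x
    ∃-few-comparable = go (proj₁ ∃-small-cell) (proj₂ ∃-small-cell) (short? _)
      where
      go : ∀ i → d * length (cell i) ≤ length P → Dec (Short i) → ∃ λ x → x ∈ P × FewComparable x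
      go i small (yes s) = ShortAxis.peak i s small , ShortAxis.peak∈ i s small , ShortAxis.few-comparable i s small
      go i small (no ¬s) = LongAxis.tip i ¬s small , axis∈ ≤-refl , LongAxis.few-comparable i ¬s small

  ideal-bound : (d ∸ 1) * length P < d * πP P + d * suc (ideal-slack d)
  ideal-bound with ∃-few-comparable
  -- Adding `length P` to both sides turns the factor `d ∸ 1` into `d`.
  ... | x , x∈ , few = +-cancelʳ-< (length P) _ _ (begin-strict
    (d ∸ 1) * length P + length P                            ≡⟨ pred-* ⟩
    d * length P                                             ≤⟨ *-monoʳ-≤ d (length≤πAt+below+above x) ⟩
    d * (πAt P x + (length (below x) + length (above x)))    ≡⟨ *-distribˡ-+ d (πAt P x) _ ⟩
    d * πAt P x + d * (length (below x) + length (above x))  ≤⟨ +-mono-≤ (*-monoʳ-≤ d (πAt≤πP x∈)) few ⟩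
    d * πP P + (length P + ideal-slack d)                    ≡⟨ swap ⟩
    -- The successor in the constant makes the bound strict; the factor `d` in front of it then only
    -- helps, as `d` is positive.
    d * πP P + ideal-slack d + length P                      <⟨ +-monoˡ-< (length P) (+-monoʳ-< (d * πP P) (n<1+n _)) ⟩
    d * πP P + suc (ideal-slack d) + length P                ≤⟨ +-monoˡ-≤ (length P) (+-monoʳ-≤ (d * πP P) (m≤n*m _ d {{>-nonZero 0<d}})) ⟩
    d * πP P + d * suc (ideal-slack d) + length P            ∎)
    where
    open ≤-Reasoning
    pred-* : (d ∸ 1) * length P + length P ≡ d * length P
    pred-* = trans (+-comm ((d ∸ 1) * length P) (length P))
      (cong (_* length P) (m+[n∸m]≡n 0<d))
    swap : d * πP P + (length P + ideal-slack d) ≡ d * πP P + ideal-slack d + length P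
    swap = trans (cong (d * πP P +_) (+-comm (length P) _)) (sym (+-assoc (d * πP P) _ _))

theorem1p9 : (d : ℕ) → .{{_ : NonZero d}} →
    ((P : List (Pt d)) → Unique P → Convex P → ¬ IsChain P →
    length P ≤ 2 * πP P + 2)
    × (∃ λ (C : ℕ) → (P : List (Pt d)) → Unique P → IsIdeal P →
    ¬ InCoordHyperplane P →
    (d ∸ 1) * length P < d * πP P + d * C)
theorem1p9 d =
    (λ P uniq convex ¬chain → convex-bound {P = P} uniq convex ¬chain)
  , suc (ideal-slack d)
  , λ P uniq ideal spanning → Ideal.ideal-bound {d} {P} (>-nonZero⁻¹ d) uniq ideal spanning
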